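{- For every $\epsilon>0$, almost all graphs have Prague dimension $d$ satisfying $$d\ \ge\ \frac{1}{1+\epsilon}\left(\frac{n-1}{2\log n}-\frac1n\right),$$ where $n$ is the number of vertices. That is, for every $\epsilon>0$, if $N_n$ denotes the number of labeled simple graphs $G$ on $n$ vertices with $\dim_P(G)\ge \frac{1}{1+\epsilon}\left(\frac{n-1}{2\log n}-\frac1n\right)$, then $N_n/2^{\binom n2}\to 1$ as $n\to\infty$.
   Context: Here $\log$ is the logarithm to base $2$. The categorical product $G_1\times G_2$ of graphs has vertex set $V(G_1)\times V(G_2)$, with $(u_1,u_2)$ and $(v_1,v_2)$ adjacent iff $u_1v_1\in E(G_1)$ and $u_2v_2\in E(G_2)$. The Prague dimension $\dim_P(G)$ of a finite simple graph $G$ is the minimal (positive) integer $d$ such that $G$ is isomorphic to an induced subgraph of a categorical product of $d$ complete graphs. A graph property holds for almost all graphs if the number of labeled $n$-vertex graphs having the property, divided by $2^{\binom n2}$, tends to $1$ as $n\to\infty$. -}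

module Defs where

open import Data.Bool.Base using (Bool; false; not; _∧_)
open import Data.Bool.Properties using (∧-zeroˡ)
open import Data.Empty using (⊥)
open import Data.Fin.Base using (Fin)
open import Data.Fin.Properties using (_≟_)
open import Data.Integer.Base using (ℤ; +_; -[1+_])
open import Data.List.Base using (List; []; _∷_)
open import Data.List.NonEmpty.Base as List⁺ using (List⁺)
open import Data.Nat.Base as ℕ using (ℕ; suc; _^_)
open import Data.Nat.Combinatorics using (_C_)
open import Data.Nat.Properties using (m^n≢0)
open import Data.Product.Base using (Σ-syntax; ∃-syntax; _×_; _,_)
open import Data.Rational.Base as ℚ using (ℚ; 0ℚ; 1ℚ; ↥_; ↧ₙ_)
open import Data.Sum.Base using (_⊎_)
open import Function.Definitions using (Injective)
open import Relation.Binary.PropositionalEquality using (_≡_; refl; sym; trans; cong; cong₂)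
open import Relation.Nullary.Decidable using (⌊_⌋; yes; no)
open import Relation.Nullary.Negation using (contradiction)

------------------------------------------------------------------------
-- Graphs

record Graph (V : Set) : Set where
  field
    adj    : V → V → Bool
    symm   : ∀ u v → adj u v ≡ adj v u
    irrefl : ∀ v → adj v v ≡ false

open Graph public

-- Equality of labelled graphs: the same edge set.
_≈ᴳ_ : ∀ {V} → Graph V → Graph V → Set
G ≈ᴳ H = ∀ u v → adj G u v ≡ adj H u v

K : ∀ m → Graph (Fin m)
K m = record { adj = λ i j → not ⌊ i ≟ j ⌋ ; symm = symm′ ; irrefl = irrefl′ }
  where
  symm′ : ∀ i j → not ⌊ i ≟ j ⌋ ≡ not ⌊ j ≟ i ⌋
  symm′ i j with i ≟ j | j ≟ i
  ... | yes _ | yes _ = refl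
  ... | no  _ | no  _ = refl
  ... | yes p | no ¬p = contradiction (sym p) ¬p
  ... | no ¬p | yes p = contradiction (sym p) ¬p

  irrefl′ : ∀ i → not ⌊ i ≟ i ⌋ ≡ false
  irrefl′ i with i ≟ i
  ... | yes _ = refl
  ... | no ¬p = contradiction refl ¬p

_⊗_ : ∀ {V W} → Graph V → Graph W → Graph (V × W)
G ⊗ H = record
  { adj    = λ (u₁ , u₂) (v₁ , v₂) → adj G u₁ v₁ ∧ adj H u₂ v₂
  ; symm   = λ (u₁ , u₂) (v₁ , v₂) → cong₂ _∧_ (symm G u₁ v₁) (symm H u₂ v₂)
  ; irrefl = λ (v₁ , v₂) →
      trans (cong (_∧ adj H v₂ v₂) (irrefl G v₁)) (∧-zeroˡ (adj H v₂ v₂))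
  }

Coords : ℕ → List ℕ → Set
Coords m []        = Fin m
Coords m (m′ ∷ ms) = Fin m × Coords m′ ms

∏K′ : ∀ m ms → Graph (Coords m ms)
∏K′ m []        = K m
∏K′ m (m′ ∷ ms) = K m ⊗ ∏K′ m′ ms

-- The product of the complete graphs whose orders are listed.
∏K : (ms : List⁺ ℕ) → Graph (Coords (List⁺.head ms) (List⁺.tail ms))
∏K ms = ∏K′ (List⁺.head ms) (List⁺.tail ms)

-- G is isomorphic to an induced subgraph of H, namely the one on the
-- image of the embedding.
_↪_ : ∀ {V W} → Graph V → Graph W → Set
_↪_ {V} {W} G H =
  Σ[ φ ∈ (V → W) ] Injective _≡_ _≡_ φ × (∀ u v → adj G u v ≡ adj H (φ u) (φ v))

EmbedsInProductOf : ∀ {V} → ℕ → Graph V → Set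
EmbedsInProductOf d G = Σ[ ms ∈ List⁺ ℕ ] List⁺.length ms ≡ d × (G ↪ ∏K ms)

IsPragueDim : ∀ {V} → Graph V → ℕ → Set
IsPragueDim G d =
  EmbedsInProductOf d G × (∀ d′ → EmbedsInProductOf d′ G → d ℕ.≤ d′)

------------------------------------------------------------------------
-- Real numbers, as two-sided Dedekind cuts of ℚ.  The operations are
-- defined on arbitrary pairs of rational predicates.

record Cut : Set₁ where
  field
    lower : ℚ → Set
    upper : ℚ → Set

open Cut public

record IsReal (x : Cut) : Set where
  field
    lower-inhabited : ∃[ q ] lower x q
    upper-inhabited : ∃[ q ] upper x q
    lower-closed    : ∀ {q r} → q ℚ.< r → lower x r → lower x q
    lower-open      : ∀ {q} → lower x q → ∃[ r ] q ℚ.< r × lower x r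
    upper-closed    : ∀ {q r} → q ℚ.< r → upper x q → upper x r
    upper-open      : ∀ {r} → upper x r → ∃[ q ] q ℚ.< r × upper x q
    disjoint        : ∀ {q} → lower x q → upper x q → ⊥
    located         : ∀ {q r} → q ℚ.< r → lower x q ⊎ upper x r

infix  4 _≤ʳ_ _<ʳ_
infixl 6 _+ʳ_ _-ʳ_
infixl 7 _*ʳ_
infix  8 _⁻¹ʳ

_≤ʳ_ : Cut → Cut → Set
x ≤ʳ y = ∀ q → lower x q → lower y q

_<ʳ_ : Cut → Cut → Set
x <ʳ y = ∃[ q ] upper x q × lower y q

fromℚ : ℚ → Cut
fromℚ p = record { lower = ℚ._< p ; upper = p ℚ.<_ }

fromℕ : ℕ → Cut
fromℕ n = fromℚ (+ n ℚ./ 1)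

_+ʳ_ : Cut → Cut → Cut
x +ʳ y = record
  { lower = λ q → ∃[ a ] ∃[ b ] lower x a × lower y b × q ℚ.< a ℚ.+ b
  ; upper = λ q → ∃[ a ] ∃[ b ] upper x a × upper y b × a ℚ.+ b ℚ.< q
  }

_-ʳ_ : Cut → Cut → Cut
x -ʳ y = record
  { lower = λ q → ∃[ a ] ∃[ b ] lower x a × upper y b × q ℚ.< a ℚ.- b
  ; upper = λ q → ∃[ a ] ∃[ b ] upper x a × lower y b × a ℚ.- b ℚ.< q
  }

-- The product of the rational intervals (a , b) and (c , d) is bounded
-- by the four products of endpoints.
_*ʳ_ : Cut → Cut → Cut
x *ʳ y = record
  { lower = λ q → ∃[ a ] ∃[ b ] ∃[ c ] ∃[ d ]
      (lower x a × upper x b) × (lower y c × upper y d) ×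
      q ℚ.< a ℚ.* c × q ℚ.< a ℚ.* d × q ℚ.< b ℚ.* c × q ℚ.< b ℚ.* d
  ; upper = λ q → ∃[ a ] ∃[ b ] ∃[ c ] ∃[ d ]
      (lower x a × upper x b) × (lower y c × upper y d) ×
      a ℚ.* c ℚ.< q × a ℚ.* d ℚ.< q × b ℚ.* c ℚ.< q × b ℚ.* d ℚ.< q
  }

-- The reciprocal of a positive real (meaningless on other arguments).
_⁻¹ʳ : Cut → Cut
x ⁻¹ʳ = record
  { lower = λ q → ∃[ r ] upper x r × 0ℚ ℚ.< r × q ℚ.* r ℚ.< 1ℚ
  ; upper = λ q → ∃[ r ] lower x r × 0ℚ ℚ.< r × 1ℚ ℚ.< q ℚ.* r
  }

-- 2 ^ a < N and N < 2 ^ a for an integer exponent a.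
2^_<_ : ℤ → ℕ → Set
2^ (+ a)    < N = 2 ^ a ℕ.< N
2^ -[1+ a ] < N = 1 ℕ.< 2 ^ suc a ℕ.* N

_<2^_ : ℕ → ℤ → Set
N <2^ (+ a)    = N ℕ.< 2 ^ a
N <2^ -[1+ a ] = 2 ^ suc a ℕ.* N ℕ.< 1

-- The base-2 logarithm of n ≥ 1: a / b < log n iff 2 ^ a < n ^ b.
log : ℕ → Cut
log n = record
  { lower = λ q → 2^ (↥ q) < (n ^ ↧ₙ q)
  ; upper = λ q → (n ^ ↧ₙ q) <2^ (↥ q)
  }

-- 1/(1+ε) · ((n - 1)/(2 log n) - 1/n), where every reciprocal is of a
-- positive real once ε > 0 and n ≥ 2.
bound : Cut → ℕ → Cut
bound ε n =
  (fromℕ 1 +ʳ ε) ⁻¹ʳ *ʳ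
  ((fromℕ n -ʳ fromℕ 1) *ʳ (fromℕ 2 *ʳ log n) ⁻¹ʳ -ʳ fromℕ n ⁻¹ʳ)

------------------------------------------------------------------------
-- Almost all graphs

GraphProperty : Set₁
GraphProperty = ∀ n → Graph (Fin n) → Set

-- f enumerates, without repetition, k labelled graphs satisfying P.
Lists : ∀ {n k} → (Graph (Fin n) → Set) → (Fin k → Graph (Fin n)) → Set
Lists P f = Injective _≡_ _≈ᴳ_ f × (∀ i → P (f i))

AtLeast : ∀ {n} → ℕ → (Graph (Fin n) → Set) → Set
AtLeast {n} k P = Σ[ f ∈ (Fin k → Graph (Fin n)) ] Lists P f

Exactly : ∀ {n} → ℕ → (Graph (Fin n) → Set) → Set
Exactly {n} k P =
  Σ[ f ∈ (Fin k → Graph (Fin n)) ] Lists P f × (∀ G → P G → ∃[ i ] f i ≈ᴳ G)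

proportion : ℕ → ℕ → ℚ
proportion n k = ℚ._/_ (+ k) (2 ^ (n C 2)) {{m^n≢0 2 (n C 2)}}

_⟶_ : (ℕ → ℚ) → ℚ → Set
s ⟶ l = ∀ δ → 0ℚ ℚ.< δ → ∃[ n₀ ] (∀ n → n₀ ℕ.≤ n → ℚ.∣ s n ℚ.- l ∣ ℚ.< δ)

-- For an undecidable P the number N n of graphs satisfying P need not be
-- available constructively.  The second component is the usual definition,
-- about any N counting P exactly; the first says the same through witnessed
-- lower bounds for that number (which never exceeds 2 ^ (n C 2)), so it is
-- meaningful without an exact count.
AlmostAll : GraphProperty → Set
AlmostAll P =
  (Σ[ k ∈ (ℕ → ℕ) ] (∀ n → AtLeast (k n) (P n)) × ((λ n → proportion n (k n)) ⟶ 1ℚ))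
  ×
  (∀ (N : ℕ → ℕ) → (∀ n → Exactly (N n) (P n)) → (λ n → proportion n (N n)) ⟶ 1ℚ)

{-# OPTIONS --safe #-}
module Submission where

-- A graph on n vertices embeds in a product of d complete graphs iff d vertex
-- colourings with at most n colours determine it, so at most n ^ (n d) labelled
-- graphs have Prague dimension ≤ d.  If d violates the bound then even for ε = 0
-- n d log n ≤ (n choose 2) − log n, hence at most a fraction 1/n of all graphs
-- has such a dimension.  For ε > 0 the bound is only weaker.

open import Data.Bool.Base using (Bool; true; false; _∧_)
open import Data.Bool.Properties as Bool using (⇔→≡)
open import Data.Fin.Base using (Fin; zero; suc; toℕ; combine; remQuot; finToFun; funToFin)
open import Data.Fin.Properties
  using (_≟_; all?; any?; 2↔Bool; toℕ-injective; suc-injective; injective⇒≤; remQuot-combine;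
         combine-remQuot; finToFun-funToFin; funToFin-finToFin)
open import Data.Integer.Base as ℤ using (+_; -[1+_])
import Data.Integer.Properties as ℤ
open import Data.List.Base using (List; []; _∷_; length; replicate)
open import Data.List.NonEmpty.Base using (_∷_)
open import Data.List.Properties using (length-replicate)
open import Data.Nat.Base as ℕ
  using (ℕ; zero; suc; _+_; _*_; _^_; _≤_; _<_; z≤n; s≤s; _≤′_; ≤′-reflexive; ≤′-step)
open import Data.Nat.Combinatorics using (_C_; nC1≡n; nCk+nC[k+1]≡[n+1]C[k+1])
open import Data.Nat.Coprimality using (Coprime)
import Data.Nat.Properties as ℕ
open import Data.Product.Base using (Σ-syntax; ∃-syntax; _×_; _,_; proj₁; proj₂; uncurry)
open import Data.Rational.Base as ℚ using (ℚ; mkℚ; 0ℚ; 1ℚ; toℚᵘ; positive; nonNegative)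
import Data.Rational.Properties as ℚ
open import Data.Rational.Solver using (module +-*-Solver)
open import Data.Rational.Unnormalised.Base as ℚᵘ using (mkℚᵘ; *≡*; *<*)
import Data.Rational.Unnormalised.Properties as ℚᵘ
open import Data.Sum.Base using (inj₁; inj₂)
open import Function.Base using (_∘_; id)
open import Function.Bundles using (_⇔_; mk⇔; Equivalence; Inverse)
open import Function.Construct.Composition using (_⇔-∘_)
open import Function.Construct.Symmetry using (⇔-sym)
open import Function.Definitions using (Injective)
open import Relation.Binary.Definitions using (DecidableEquality)
open import Relation.Binary.PropositionalEquality
  using (_≡_; _≢_; refl; sym; trans; cong; cong₂; subst; subst₂; module ≡-Reasoning)
open import Relation.Nullary.Decidable using (Dec; yes; no; ¬?; map′; _×-dec_; _→-dec_)
open import Relation.Nullary.Negation using (¬_; contradiction)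
open import Relation.Unary using (Pred; Decidable)
open import Defs

open Equivalence using (to; from)

-- Least witnesses and finite partitions

Least : (ℕ → Set) → ℕ → Set
Least P d = P d × (∀ d′ → P d′ → d ≤ d′)

least : ∀ {P : ℕ → Set} → Decidable P → ∀ m → P m → ∃[ d ] Least P d
least {P} P? m Pm with P? 0
least {P} P? m Pm       | yes P0 = 0 , P0 , λ _ _ → z≤n
least {P} P? zero P0    | no ¬P0 = contradiction P0 ¬P0
least {P} P? (suc m) Pm | no ¬P0 with least (P? ∘ suc) m Pm
... | d , Pd , minimal = suc d , Pd ,
  λ { zero P0 → contradiction P0 ¬P0 ; (suc d′) Pd′ → s≤s (minimal d′ Pd′) }

-- Both classes are enumerated because both are counted: the `yesᶠ` class is bounded above by codes,
-- while the `noᶠ` class supplies the list that `AtLeast` asks for.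
record Partition {m} (P : Pred (Fin m) _) : Set where
  field
    #yes #no : ℕ
    total   : #yes + #no ≡ m
    yesᶠ    : Fin #yes → Fin m
    yes-inj : Injective _≡_ _≡_ yesᶠ
    yes-P   : ∀ i → P (yesᶠ i)
    noᶠ     : Fin #no → Fin m
    no-inj  : Injective _≡_ _≡_ noᶠ
    no-¬P   : ∀ i → ¬ P (noᶠ i)

extend : ∀ {k m} → (Fin k → Fin m) → Fin (suc k) → Fin (suc m)
extend f zero    = zero
extend f (suc i) = suc (f i)

extend-inj : ∀ {k m} {f : Fin k → Fin m} → Injective _≡_ _≡_ f → Injective _≡_ _≡_ (extend f)
extend-inj f-inj {zero}  {zero}  _  = refl
extend-inj f-inj {suc i} {suc j} eq = cong suc (f-inj (suc-injective eq))

partition : ∀ {m} {P : Pred (Fin m) _} → Decidable P → Partition P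
partition {zero} P? = record
  { #yes = 0 ; #no = 0 ; total = refl
  ; yesᶠ = λ () ; yes-inj = λ { {()} } ; yes-P = λ ()
  ; noᶠ  = λ () ; no-inj  = λ { {()} } ; no-¬P = λ () }
partition {suc m} P? with P? zero | partition (P? ∘ suc)
... | yes P0 | p = record
  { #yes = suc #yes ; #no = #no
  ; total   = cong suc total
  ; yesᶠ    = extend yesᶠ
  ; yes-inj = extend-inj yes-inj
  ; yes-P   = λ { zero → P0 ; (suc i) → yes-P i }
  ; noᶠ     = suc ∘ noᶠ
  ; no-inj  = no-inj ∘ suc-injective
  ; no-¬P   = no-¬P }
  where open Partition p
... | no ¬P0 | p = record
  { #yes = #yes ; #no = suc #no
  ; total   = trans (ℕ.+-suc #yes #no) (cong suc total)
  ; yesᶠ    = suc ∘ yesᶠ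
  ; yes-inj = yes-inj ∘ suc-injective
  ; yes-P   = yes-P
  ; noᶠ     = extend noᶠ
  ; no-inj  = extend-inj no-inj
  ; no-¬P   = λ { zero → ¬P0 ; (suc i) → no-¬P i } }
  where open Partition p

-- Colourings

-- Here `c i` plays the i-th coordinate of a map into a product of complete graphs: `adjacency`
-- matches adjacency in the product and `separates` is injectivity of the map.
record Represents {V A : Set} {d} (c : Fin d → V → A) (G : Graph V) : Set where
  constructor represents
  field
    adjacency : ∀ u v → adj G u v ≡ true ⇔ (∀ i → c i u ≢ c i v)
    separates : ∀ u v → (∀ i → c i u ≡ c i v) → u ≡ v

open Represents

Representable : ∀ {n} → ℕ → Graph (Fin n) → Set
Representable {n} d G = Σ[ c ∈ (Fin d → Fin n → Fin n) ] Represents c G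

represents-unique : ∀ {V A : Set} {d} {c : Fin d → V → A} {G H} →
                    Represents c G → Represents c H → G ≈ᴳ H
represents-unique cG cH u v = ⇔→≡ (⇔-sym (adjacency cH u v) ⇔-∘ adjacency cG u v)

-- Both conditions depend only on which pairs of vertices each colouring identifies, so it suffices
-- that the two families induce the same equivalence relations on `V`.
represents-resp : ∀ {V A B : Set} {d e} {c : Fin d → V → A} {c′ : Fin e → V → B} {G} →
  (∀ i → ∃[ j ] ∀ u v → c i u ≡ c i v ⇔ c′ j u ≡ c′ j v) →
  (∀ j → ∃[ i ] ∀ u v → c i u ≡ c i v ⇔ c′ j u ≡ c′ j v) →
  Represents c G → Represents c′ G
represents-resp f g cG = represents
  (λ u v → mk⇔
    (λ p j eq → to (adjacency cG u v) p (proj₁ (g j)) (from (proj₂ (g j) u v) eq))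
    (λ p → from (adjacency cG u v) λ i eq → p (proj₁ (f i)) (to (proj₂ (f i) u v) eq)))
  (λ u v p → separates cG u v λ i → from (proj₂ (f i) u v) (p (proj₁ (f i))))

represents? : ∀ {m n d} (c : Fin d → Fin m → Fin n) G → Dec (Represents c G)
represents? c G = map′ (uncurry represents) (λ r → adjacency r , separates r)
  (all? (λ u → all? λ v → map′ (uncurry mk⇔) (λ e → to e , from e)
      ((adj G u v Bool.≟ true →-dec differ u v) ×-dec (differ u v →-dec adj G u v Bool.≟ true)))
    ×-dec all? (λ u → all? λ v → all? (λ i → c i u ≟ c i v) →-dec u ≟ v))
  where
  differ : ∀ u v → Dec (∀ i → c i u ≢ c i v)
  differ u v = all? λ i → ¬? (c i u ≟ c i v)

decode : ∀ {m n d} → Fin ((n ^ d) ^ m) → Fin d → Fin m → Fin n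
decode x i v = finToFun (finToFun x v) i

encode : ∀ {m n d} → (Fin d → Fin m → Fin n) → Fin ((n ^ d) ^ m)
encode c = funToFin λ v → funToFin λ i → c i v

decode-encode : ∀ {m n d} (c : Fin d → Fin m → Fin n) i v → decode (encode c) i v ≡ c i v
decode-encode c i v = begin
  finToFun (finToFun (funToFin λ v → funToFin λ i → c i v) v) i
    ≡⟨ cong (λ x → finToFun x i) (finToFun-funToFin (λ v → funToFin λ i → c i v) v) ⟩
  finToFun (funToFin λ i → c i v) i
    ≡⟨ finToFun-funToFin (λ i → c i v) i ⟩
  c i v ∎
  where open ≡-Reasoning

-- `decode` inverts `encode` pointwise, which is enough because only equality of colours matters.
-- The number of codes, `(n ^ d) ^ n`, is the bound used in the counting.
representable-code : ∀ {n d} {G : Graph (Fin n)} → Representable d G →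
                     Σ[ x ∈ Fin ((n ^ d) ^ n) ] Represents (decode x) G
representable-code {G = G} (c , cG) = encode c , represents-resp (λ i → i , same i) (λ i → i , same i) cG
  where
  same : ∀ i u v → c i u ≡ c i v ⇔ decode (encode c) i u ≡ decode (encode c) i v
  same i u v rewrite decode-encode c i u | decode-encode c i v = mk⇔ id id

-- A search through the finitely many codes. Decidability yields both a least dimension for each
-- graph and a partition of all graphs on `n` vertices.
representable? : ∀ {n} d (G : Graph (Fin n)) → Dec (Representable d G)
representable? d G =
  map′ (λ (x , r) → decode x , r) representable-code (any? λ x → represents? (decode x) G)

-- Repeating a colouring affects neither condition; the successors provide a first colouring to
-- repeat.
representable-≤ : ∀ {n d e} {G : Graph (Fin n)} → d ≤ e → Representable (suc d) G → Representable (suc e) G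
representable-≤ {G = G} d≤e (c , cG) = go (ℕ.≤⇒≤′ d≤e)
  where
  go : ∀ {e} → _ ≤′ e → Representable (suc e) G
  go (≤′-reflexive refl) = c , cG
  go (≤′-step p) with go p
  ... | c′ , c′G = repeat , represents-resp
          (λ i → suc i , λ _ _ → mk⇔ id id)
          (λ { zero → zero , (λ _ _ → mk⇔ id id) ; (suc i) → i , (λ _ _ → mk⇔ id id) }) c′G
    where
    repeat : Fin (suc (suc _)) → _ → _
    repeat zero    = c′ zero
    repeat (suc i) = c′ i

-- Every colour class is renamed to one of its vertices.
compress : ∀ {n} {A : Set} → DecidableEquality A → (g : Fin n → A) →
           Σ[ h ∈ (Fin n → Fin n) ] ∀ u v → g u ≡ g v ⇔ h u ≡ h v
compress {n} {A} _≟ᴬ_ g = (λ v → proj₁ (rep (g v) (v , refl))) , λ u v → mk⇔ (rep-cong u v) (λ eq →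
    trans (sym (proj₂ (rep (g u) (u , refl)))) (trans (cong g eq) (proj₂ (rep (g v) (v , refl)))))
  where
  rep : ∀ a → ∃[ v ] g v ≡ a → ∃[ w ] g w ≡ a
  rep a witness with any? (λ w → g w ≟ᴬ a)
  ... | yes p = p
  ... | no ¬p = contradiction witness ¬p

  -- The chosen vertex must depend on the colour alone. The witness merely excludes the failing
  -- branch of the search, so any two witnesses lead to the same choice.
  rep-irr : ∀ a p q → rep a p ≡ rep a q
  rep-irr a p q with any? (λ w → g w ≟ᴬ a)
  ... | yes _ = refl
  ... | no ¬p = contradiction p ¬p

  rep-cong′ : ∀ {a b} → a ≡ b → ∀ p q → proj₁ (rep a p) ≡ proj₁ (rep b q)
  rep-cong′ refl p q = cong proj₁ (rep-irr _ p q)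

  rep-cong : ∀ u v → g u ≡ g v → proj₁ (rep (g u) (u , refl)) ≡ proj₁ (rep (g v) (v , refl))
  rep-cong u v eq = rep-cong′ eq _ _

-- Products of complete graphs as families of colourings

∧-true : ∀ {a b} → a ∧ b ≡ true ⇔ (a ≡ true × b ≡ true)
∧-true {true}  {true}  = mk⇔ (λ _ → refl , refl) (λ _ → refl)
∧-true {true}  {false} = mk⇔ (λ ()) (λ { (_ , ()) })
∧-true {false} {_}     = mk⇔ (λ ()) (λ { (() , _) })

K-adj : ∀ {m} (i j : Fin m) → adj (K m) i j ≡ true ⇔ i ≢ j
K-adj i j with i ≟ j
... | yes i≡j = mk⇔ (λ ()) (λ i≢j → contradiction i≡j i≢j)
... | no  i≢j = mk⇔ (λ _ → i≢j) (λ _ → refl)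

-- Values lie in `ℕ` because the factors may have different orders, while a family of colourings has
-- a single type of colours.
coordinate : ∀ m ms → Fin (suc (length ms)) → Coords m ms → ℕ
coordinate m []        i       x       = toℕ x
coordinate m (m′ ∷ ms) zero    (x , _) = toℕ x
coordinate m (m′ ∷ ms) (suc i) (_ , y) = coordinate m′ ms i y

coordinate-adj : ∀ m ms x y →
  adj (∏K′ m ms) x y ≡ true ⇔ (∀ i → coordinate m ms i x ≢ coordinate m ms i y)
coordinate-adj m [] x y = mk⇔
  (λ p _ → to (K-adj x y) p ∘ toℕ-injective)
  (λ p → from (K-adj x y) λ { refl → p zero refl })
coordinate-adj m (m′ ∷ ms) (x , x′) (y , y′) = mk⇔
  (λ p → λ { zero    → to (K-adj x y) (proj₁ (to ∧-true p)) ∘ toℕ-injective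
           ; (suc i) → to (coordinate-adj m′ ms x′ y′) (proj₂ (to ∧-true p)) i })
  (λ p → from ∧-true ( from (K-adj x y) (λ { refl → p zero refl })
                     , from (coordinate-adj m′ ms x′ y′) (p ∘ suc)))

coordinate-injective : ∀ m ms x y → (∀ i → coordinate m ms i x ≡ coordinate m ms i y) → x ≡ y
coordinate-injective m []        x        y        eq = toℕ-injective (eq zero)
coordinate-injective m (m′ ∷ ms) (x , x′) (y , y′) eq =
  cong₂ _,_ (toℕ-injective (eq zero)) (coordinate-injective m′ ms x′ y′ (eq ∘ suc))

tuple : ∀ {n} d → (Fin (suc d) → Fin n) → Coords n (replicate d n)
tuple zero    a = a zero
tuple (suc d) a = a zero , tuple d (a ∘ suc)

tuple-adj : ∀ {n} d (a b : Fin (suc d) → Fin n) →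
            adj (∏K′ n (replicate d n)) (tuple d a) (tuple d b) ≡ true ⇔ (∀ i → a i ≢ b i)
tuple-adj zero a b = mk⇔ (λ { p zero → to (K-adj _ _) p }) (λ p → from (K-adj _ _) (p zero))
tuple-adj (suc d) a b = mk⇔
  (λ p → λ { zero    → to (K-adj _ _) (proj₁ (to ∧-true p))
           ; (suc i) → to (tuple-adj d (a ∘ suc) (b ∘ suc)) (proj₂ (to ∧-true p)) i })
  (λ p → from ∧-true (from (K-adj _ _) (p zero) , from (tuple-adj d (a ∘ suc) (b ∘ suc)) (p ∘ suc)))

tuple-injective : ∀ {n} d (a b : Fin (suc d) → Fin n) → tuple d a ≡ tuple d b → ∀ i → a i ≡ b i
tuple-injective zero    a b eq zero    = eq
tuple-injective (suc d) a b eq zero    = cong proj₁ eq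
tuple-injective (suc d) a b eq (suc i) = tuple-injective d (a ∘ suc) (b ∘ suc) (cong proj₂ eq) i

-- The coordinates of the embedding represent `G`, but with factors of arbitrary order. A colouring
-- of `n` vertices uses at most `n` colours, so `compress` moves each one into `Fin n` and only
-- finitely many candidates remain.
embeds⇒representable : ∀ {n d} {G : Graph (Fin n)} → EmbedsInProductOf d G → Representable d G
embeds⇒representable {G = G} ((m ∷ ms) , refl , φ , φ-inj , φ-adj) =
  (λ i → proj₁ (compressed i)) ,
  represents-resp (λ i → i , proj₂ (compressed i)) (λ i → i , proj₂ (compressed i))
    (represents
      (λ u v → subst (λ b → b ≡ true ⇔ _) (sym (φ-adj u v)) (coordinate-adj m ms (φ u) (φ v)))
      (λ u v eq → φ-inj (coordinate-injective m ms (φ u) (φ v) eq)))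
  where
  compressed : ∀ i → _
  compressed i = compress ℕ._≟_ (λ v → coordinate m ms i (φ v))

representable⇒embeds : ∀ {n d} {G : Graph (Fin n)} → Representable (suc d) G → EmbedsInProductOf (suc d) G
representable⇒embeds {n} {d} {G} (c , cG) =
  (n ∷ replicate d n) , cong suc (length-replicate d) , φ ,
  (λ {u} {v} eq → separates cG u v (tuple-injective d _ _ eq)) ,
  (λ u v → ⇔→≡ (⇔-sym (tuple-adj d _ _) ⇔-∘ adjacency cG u v))
  where
  φ : Fin n → Coords n (replicate d n)
  φ v = tuple d λ i → c i v

-- One coordinate separates the vertices; every pair of non-adjacent vertices
-- is merged by a coordinate of its own.
representable-n²+1 : ∀ {n} (G : Graph (Fin n)) → Representable (suc (n * n)) G
representable-n²+1 {n} G = c , represents (λ u v → mk⇔ (proper u v) (complete u v)) (λ u v eq → eq zero)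
  where
  -- `merge a b` moves `a` to `b` if they are non-adjacent and fixes everything else, so `a` and `b`
  -- are the only distinct vertices it can identify.
  merge : Fin n → Fin n → Fin n → Fin n
  merge a b w with w ≟ a | adj G a b
  ... | yes _ | false = b
  ... | yes _ | true  = w
  ... | no  _ | _     = w

  c : Fin (suc (n * n)) → Fin n → Fin n
  c zero    w = w
  c (suc j) w = merge (proj₁ (remQuot {n} n j)) (proj₂ (remQuot {n} n j)) w

  merge-left : ∀ a b → adj G a b ≡ false → merge a b a ≡ b
  merge-left a b eq with a ≟ a | adj G a b
  ... | yes _ | false = refl
  ... | no ¬p | _     = contradiction refl ¬p

  merge-right : ∀ a b → merge a b b ≡ b
  merge-right a b with b ≟ a | adj G a b
  ... | yes _ | false = refl
  ... | yes _ | true  = refl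
  ... | no _  | _     = refl

  adj⇒≢ : ∀ u v → adj G u v ≡ true → u ≢ v
  adj⇒≢ u v p refl = contradiction (trans (sym p) (irrefl G u)) λ ()

  merge-proper : ∀ a b u v → adj G u v ≡ true → merge a b u ≢ merge a b v
  merge-proper a b u v p eq with u ≟ a | v ≟ a | adj G a b in ab
  ... | yes refl | yes refl | _     = adj⇒≢ u v p refl
  -- Here `u` is moved to `b` and `v` stays, so a collision makes `v` equal to `b`, a non-neighbour
  -- of `u`.
  ... | yes refl | no _     | false = contradiction (trans (sym p) (trans (cong (adj G u) (sym eq)) ab)) λ ()
  ... | yes _    | no _     | true  = adj⇒≢ u v p eq
  ... | no _     | yes refl | false =
    contradiction (trans (sym p) (trans (symm G u v) (trans (cong (adj G v) eq) ab))) λ ()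
  ... | no _     | yes _    | true  = adj⇒≢ u v p eq
  ... | no _     | no _     | _     = adj⇒≢ u v p eq

  proper : ∀ u v → adj G u v ≡ true → ∀ i → c i u ≢ c i v
  proper u v p zero    = adj⇒≢ u v p
  proper u v p (suc j) = merge-proper _ _ u v p

  complete : ∀ u v → (∀ i → c i u ≢ c i v) → adj G u v ≡ true
  complete u v p with adj G u v in uv
  ... | true  = refl
  ... | false = contradiction merged (p (suc (combine u v)))
    where
    merged : c (suc (combine u v)) u ≡ c (suc (combine u v)) v
    merged = trans (trans (at u) (merge-left u v uv)) (sym (trans (at v) (merge-right u v)))
      where
      at : ∀ w → c (suc (combine u v)) w ≡ merge u v w
      at w = cong (λ ab → merge (proj₁ ab) (proj₂ ab) w) (remQuot-combine u v)

-- The representation by `suc (n * n)` colourings bounds the search for a least dimension. A product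
-- has at least one factor, so searching over successors covers every possible dimension.
pragueDim : ∀ {n} (G : Graph (Fin n)) → ∃[ d ] IsPragueDim G (suc d)
pragueDim {n} G with least (λ d → representable? (suc d) G) (n * n) (representable-n²+1 G)
... | d , rep , minimal = d , representable⇒embeds rep , lower-bound
  where
  lower-bound : ∀ d′ → EmbedsInProductOf d′ G → suc d ≤ d′
  lower-bound zero     (_ , () , _)
  lower-bound (suc d′) e = s≤s (minimal d′ (embeds⇒representable e))

-- Labelled graphs

-- The factor `2 ^ n` counts the neighbourhoods of a new vertex; the recursion follows that of
-- `graph`, and `#graphs≡` turns it into a binomial exponent by Pascal's rule.
#graphs : ℕ → ℕ
#graphs zero    = 1
#graphs (suc n) = 2 ^ n * #graphs n

#graphs≡ : ∀ n → #graphs n ≡ 2 ^ (n C 2)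
#graphs≡ zero    = refl
#graphs≡ (suc n) = begin
  2 ^ n * #graphs n          ≡⟨ cong (2 ^ n *_) (#graphs≡ n) ⟩
  2 ^ n * 2 ^ (n C 2)        ≡⟨ ℕ.^-distribˡ-+-* 2 n (n C 2) ⟨
  2 ^ (n + n C 2)            ≡⟨ cong (λ k → 2 ^ (k + n C 2)) (nC1≡n n) ⟨
  2 ^ (n C 1 + n C 2)        ≡⟨ cong (2 ^_) (nCk+nC[k+1]≡[n+1]C[k+1] n 1) ⟩
  2 ^ (suc n C 2)            ∎
  where open ≡-Reasoning

bool : Fin 2 → Bool
bool = Inverse.to 2↔Bool

cone : ∀ {n} → (Fin n → Bool) → Graph (Fin n) → Graph (Fin (suc n))
cone {n} b G = record { adj = adj′ ; symm = symm′ ; irrefl = irrefl′ }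
  where
  adj′ : Fin (suc n) → Fin (suc n) → Bool
  adj′ zero    zero    = false
  adj′ zero    (suc v) = b v
  adj′ (suc u) zero    = b u
  adj′ (suc u) (suc v) = adj G u v

  symm′ : ∀ u v → adj′ u v ≡ adj′ v u
  symm′ zero    zero    = refl
  symm′ zero    (suc v) = refl
  symm′ (suc u) zero    = refl
  symm′ (suc u) (suc v) = symm G u v

  irrefl′ : ∀ v → adj′ v v ≡ false
  irrefl′ zero    = refl
  irrefl′ (suc v) = irrefl G v

delete-zero : ∀ {n} → Graph (Fin (suc n)) → Graph (Fin n)
delete-zero G = record
  { adj = λ u v → adj G (suc u) (suc v) ; symm = λ _ _ → symm G _ _ ; irrefl = λ _ → irrefl G _ }

cone-≈ : ∀ {n b} {H : Graph (Fin n)} {G} → (∀ v → b v ≡ adj G zero (suc v)) → H ≈ᴳ delete-zero G →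
         cone b H ≈ᴳ G
cone-≈ {G = G} b≡ H≈ zero    zero    = sym (irrefl G zero)
cone-≈ {G = G} b≡ H≈ zero    (suc v) = b≡ v
cone-≈ {G = G} b≡ H≈ (suc u) zero    = trans (b≡ u) (symm G zero (suc u))
cone-≈ {G = G} b≡ H≈ (suc u) (suc v) = H≈ u v

graph : ∀ n → Fin (#graphs n) → Graph (Fin n)
graph zero    _ = record { adj = λ () ; symm = λ () ; irrefl = λ () }
graph (suc n) x = expand (remQuot (#graphs n) x)
  where
  expand : Fin (2 ^ n) × Fin (#graphs n) → Graph (Fin (suc n))
  expand (s , y) = cone (bool ∘ finToFun s) (graph n y)

index : ∀ n → Graph (Fin n) → Fin (#graphs n)
index zero    G = zero
index (suc n) G =
  combine (funToFin (Inverse.from 2↔Bool ∘ adj G zero ∘ suc)) (index n (delete-zero G))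

graph-index : ∀ n G → graph n (index n G) ≈ᴳ G
graph-index zero    G = λ ()
graph-index (suc n) G u v = trans
  (cong (λ (s , y) → adj (cone (bool ∘ finToFun s) (graph n y)) u v)
        (remQuot-combine (funToFin neighbours) (index n (delete-zero G))))
  (cone-≈ {G = G}
    (λ w → trans (cong bool (finToFun-funToFin neighbours w))
                 (Inverse.strictlyInverseˡ 2↔Bool (adj G zero (suc w))))
    (graph-index n (delete-zero G)) u v)
  where
  neighbours : Fin n → Fin 2
  neighbours = Inverse.from 2↔Bool ∘ adj G zero ∘ suc

index-injective : ∀ n {G H} → index n G ≡ index n H → G ≈ᴳ H
index-injective n {G} {H} eq u v =
  trans (sym (graph-index n G u v)) (trans (cong (λ x → adj (graph n x) u v) eq) (graph-index n H u v))

funToFin-cong : ∀ {m n} {f g : Fin m → Fin n} → (∀ i → f i ≡ g i) → funToFin f ≡ funToFin g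
funToFin-cong {zero}  eq = refl
funToFin-cong {suc m} eq = cong₂ combine (eq zero) (funToFin-cong (eq ∘ suc))

index-cong : ∀ n {G H} → G ≈ᴳ H → index n G ≡ index n H
index-cong zero    eq = refl
index-cong (suc n) eq = cong₂ combine
  (funToFin-cong λ v → cong (Inverse.from 2↔Bool) (eq zero (suc v)))
  (index-cong n λ u v → eq (suc u) (suc v))

index-graph : ∀ n x → index n (graph n x) ≡ x
index-graph zero    zero = refl
index-graph (suc n) x = trans
  (cong₂ combine
    (trans (funToFin-cong λ v → Inverse.strictlyInverseʳ 2↔Bool (finToFun {2} {n} s v))
           (funToFin-finToFin {n} s))
    (trans (index-cong n λ _ _ → refl) (index-graph n y)))
  (combine-remQuot {2 ^ n} (#graphs n) x)
  where
  s = proj₁ (remQuot {2 ^ n} (#graphs n) x)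
  y = proj₂ (remQuot {2 ^ n} (#graphs n) x)

graph-injective : ∀ n → Injective _≡_ _≈ᴳ_ (graph n)
graph-injective n {x} {y} eq = trans (sym (index-graph n x)) (trans (index-cong n eq) (index-graph n y))

-- A code determines the graph it represents, so choosing a code for each representable graph is
-- injective and bounds `l`. The other graphs are listed.
count-not-representable : ∀ n d → ∃[ k ] ∃[ l ]
  k + l ≡ 2 ^ (n C 2) × l ≤ (n ^ d) ^ n × AtLeast k (λ (G : Graph (Fin n)) → ¬ Representable d G)
count-not-representable n d =
  #no , #yes , trans (ℕ.+-comm #no #yes) (trans total (#graphs≡ n)) ,
  injective⇒≤ {f = code} code-injective ,
  graph n ∘ noᶠ , no-inj ∘ graph-injective n , no-¬P
  where
  open Partition (partition (representable? d ∘ graph n))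

  code : Fin #yes → Fin ((n ^ d) ^ n)
  code i = proj₁ (representable-code (yes-P i))

  code-injective : Injective _≡_ _≡_ code
  code-injective {i} {j} eq = yes-inj (graph-injective n (represents-unique
    (proj₂ (representable-code (yes-P i)))
    (subst (λ x → Represents (decode {n} {n} {d} x) (graph n (yesᶠ j))) (sym eq)
           (proj₂ (representable-code (yes-P j))))))

lists-≤ : ∀ {n k} {P : Graph (Fin n) → Set} → AtLeast k P → k ≤ 2 ^ (n C 2)
lists-≤ {n} {k} (f , f-inj , _) =
  subst (k ≤_) (#graphs≡ n) (injective⇒≤ {f = index n ∘ f} λ {i} {j} eq → f-inj (index-injective n {f i} {f j} eq))

-- Each graph of the first list is sent to an index of the exhaustive list at which it occurs; equal
-- indices mean equal graphs.
atLeast-≤-exactly : ∀ {n k N} {P : Graph (Fin n) → Set} → AtLeast k P → Exactly N P → k ≤ N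
atLeast-≤-exactly (f , f-inj , fP) (g , _ , cover) =
  injective⇒≤ {f = λ i → proj₁ (cover (f i) (fP i))} λ {i} {j} eq → f-inj λ u v →
    trans (sym (proj₂ (cover (f i) (fP i)) u v))
      (trans (cong (λ x → adj (g x) u v) eq) (proj₂ (cover (f j) (fP j)) u v))

-- The threshold dimension

-- Taking logarithms, d > (n - 1)/(2 log n) - 1/n.
Large : ℕ → ℕ → Set
Large n d = 2 ^ (n C 2) < n ^ suc (n * d)

n<2^n : ∀ n → n < 2 ^ n
n<2^n zero    = s≤s z≤n
n<2^n (suc n) = begin
  suc (suc n)    ≤⟨ ℕ.+-mono-≤ (ℕ.m^n>0 2 n) (n<2^n n) ⟩
  2 ^ n + 2 ^ n  ≡⟨ cong (λ k → 2 ^ n + k) (ℕ.+-identityʳ (2 ^ n)) ⟨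
  2 ^ suc n      ∎
  where open ℕ.≤-Reasoning

n≤2^nC2 : ∀ n → n ≤ 2 ^ (n C 2)
n≤2^nC2 zero    = z≤n
n≤2^nC2 (suc n) = begin
  suc n                ≤⟨ n<2^n n ⟩
  2 ^ n                ≤⟨ ℕ.^-monoʳ-≤ 2 (ℕ.m≤m+n n (n C 2)) ⟩
  2 ^ (n + n C 2)      ≡⟨ cong (λ k → 2 ^ (k + n C 2)) (nC1≡n n) ⟨
  2 ^ (n C 1 + n C 2)  ≡⟨ cong (2 ^_) (nCk+nC[k+1]≡[n+1]C[k+1] n 1) ⟩
  2 ^ (suc n C 2)      ∎
  where open ℕ.≤-Reasoning

-- This only starts the search for the least large value. At `d = n C 2` the exponent on the right
-- already exceeds `n C 2`, and the base is at least 2.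
large-exists : ∀ n → 2 ≤ n → Large n (n C 2)
large-exists n@(suc _) 2≤n = begin-strict
  2 ^ (n C 2)            <⟨ ℕ.^-monoʳ-< 2 (s≤s (s≤s z≤n)) (s≤s (ℕ.m≤n*m (n C 2) n)) ⟩
  2 ^ suc (n * (n C 2))  ≤⟨ ℕ.^-monoˡ-≤ (suc (n * (n C 2))) 2≤n ⟩
  n ^ suc (n * (n C 2))  ∎
  where open ℕ.≤-Reasoning

large-mono : ∀ n {d e} → 2 ≤ n → d ≤ e → Large n d → Large n e
large-mono n@(suc _) 2≤n d≤e large =
  ℕ.<-≤-trans large (ℕ.^-monoʳ-≤ n (s≤s (ℕ.*-monoʳ-≤ n d≤e)))

-- The cut-off D is the largest with n ^ (n D + 1) ≤ 2 ^ (n C 2): the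
-- exponent n D + 1 rather than n D is what makes the exceptions a 1/n fraction.
most-large : ∀ n → 2 ≤ n → ∃[ k ] ∃[ l ] k + l ≡ 2 ^ (n C 2) × n * l ≤ 2 ^ (n C 2) ×
  AtLeast k (λ (G : Graph (Fin n)) → ∃[ d ] IsPragueDim G d × Large n d)
most-large n 2≤n with least (λ d → 2 ^ (n C 2) ℕ.<? n ^ suc (n * d)) (n C 2) (large-exists n 2≤n)
-- `Large n 0` amounts to `2 ^ (n C 2) < n`, which is false; hence the least large value has a
-- predecessor `D`.
... | zero , large , _ = contradiction (n≤2^nC2 n)
        (ℕ.<⇒≱ (subst (2 ^ (n C 2) <_) (trans (cong (λ m → n ^ suc m) (ℕ.*-zeroʳ n)) (ℕ.*-identityʳ n)) large))
... | suc D , large , minimal with count-not-representable n D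
... | k , l , total , l≤ , f , f-inj , f-notRep = k , l , total , n*l≤ , f , f-inj , λ i → dim (f i) (f-notRep i)
  where
  n*l≤ : n * l ≤ 2 ^ (n C 2)
  n*l≤ = begin
    n * l              ≤⟨ ℕ.*-monoʳ-≤ n l≤ ⟩
    n * (n ^ D) ^ n    ≡⟨ cong (n *_) (ℕ.^-*-assoc n D n) ⟩
    n * n ^ (D * n)    ≡⟨ cong (λ m → n ^ suc m) (ℕ.*-comm D n) ⟩
    -- `D` lies below the least large value, so it is not large.
    n ^ suc (n * D)    ≤⟨ ℕ.≮⇒≥ (λ large → ℕ.<-irrefl refl (minimal D large)) ⟩
    2 ^ (n C 2)        ∎
    where open ℕ.≤-Reasoning

  dim : ∀ G → ¬ Representable D G → ∃[ d ] IsPragueDim G d × Large n d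
  dim G notRep with pragueDim G
  -- A dimension of at most `D` could be padded to `D` colourings. So `suc d` is at least the least
  -- large value, and `Large` is monotone.
  ... | d , isDim@(embeds , _) = suc d , isDim , large-mono n 2≤n (ℕ.≰⇒> too-small) large
    where
    too-small : ¬ suc d ≤ D
    too-small (s≤s d≤) = notRep (representable-≤ d≤ (embeds⇒representable embeds))

-- Rational arithmetic

ι : ℕ → ℚ
ι n = + n ℚ./ 1

toℚᵘ-/ : ∀ i n .{{_ : ℕ.NonZero n}} → toℚᵘ (i ℚ./ n) ℚᵘ.≃ (i ℚᵘ./ n)
toℚᵘ-/ i (suc n) = ℚ.toℚᵘ-fromℚᵘ (mkℚᵘ i n)

/-+-/ : ∀ m n d .{{_ : ℕ.NonZero d}} → (+ m ℚ./ d) ℚ.+ (+ n ℚ./ d) ≡ + (m ℕ.+ n) ℚ./ d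
/-+-/ m n d@(suc _) = ℚ.toℚᵘ-injective (begin
  toℚᵘ ((+ m ℚ./ d) ℚ.+ (+ n ℚ./ d))         ≈⟨ ℚ.toℚᵘ-homo-+ (+ m ℚ./ d) (+ n ℚ./ d) ⟩
  toℚᵘ (+ m ℚ./ d) ℚᵘ.+ toℚᵘ (+ n ℚ./ d)     ≈⟨ ℚᵘ.+-cong (toℚᵘ-/ (+ m) d) (toℚᵘ-/ (+ n) d) ⟩
  (+ m ℚᵘ./ d) ℚᵘ.+ (+ n ℚᵘ./ d)             ≈⟨ *≡* eq ⟩
  + (m ℕ.+ n) ℚᵘ./ d                         ≈⟨ toℚᵘ-/ (+ (m ℕ.+ n)) d ⟨
  toℚᵘ (+ (m ℕ.+ n) ℚ./ d)                   ∎)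
  where
  open ℚᵘ.≃-Reasoning
  eq : (+ m ℤ.* + d ℤ.+ + n ℤ.* + d) ℤ.* + d ≡ + (m ℕ.+ n) ℤ.* (+ d ℤ.* + d)
  eq = trans (cong (ℤ._* + d) (sym (ℤ.*-distribʳ-+ (+ d) (+ m) (+ n)))) (ℤ.*-assoc (+ m ℤ.+ + n) (+ d) (+ d))

ι-+ : ∀ m n → ι m ℚ.+ ι n ≡ ι (m ℕ.+ n)
ι-+ m n = /-+-/ m n 1

ι-* : ∀ m n → ι m ℚ.* ι n ≡ ι (m ℕ.* n)
ι-* m n = ℚ.toℚᵘ-injective (begin
  toℚᵘ (ι m ℚ.* ι n)              ≈⟨ ℚ.toℚᵘ-homo-* (ι m) (ι n) ⟩
  toℚᵘ (ι m) ℚᵘ.* toℚᵘ (ι n)      ≈⟨ ℚᵘ.*-cong (toℚᵘ-/ (+ m) 1) (toℚᵘ-/ (+ n) 1) ⟩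
  (+ m ℚᵘ./ 1) ℚᵘ.* (+ n ℚᵘ./ 1)  ≈⟨ *≡* (cong (ℤ._* + 1) (sym (ℤ.pos-* m n))) ⟩
  + (m ℕ.* n) ℚᵘ./ 1              ≈⟨ toℚᵘ-/ (+ (m ℕ.* n)) 1 ⟨
  toℚᵘ (ι (m ℕ.* n))              ∎)
  where open ℚᵘ.≃-Reasoning

/-<-ℚ : ∀ m d .{{_ : ℕ.NonZero d}} p e-1 .(c : Coprime p (suc e-1)) →
        m ℕ.* suc e-1 ℕ.< p ℕ.* d → (+ m ℚ./ d) ℚ.< mkℚ (+ p) e-1 c
/-<-ℚ m d@(suc _) p e-1 c lt = ℚ.toℚᵘ-cancel-<
  (ℚᵘ.<-respˡ-≃ (ℚᵘ.≃-sym (toℚᵘ-/ (+ m) d))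
    (*<* (subst₂ ℤ._<_ (ℤ.pos-* m (suc e-1)) (ℤ.pos-* p d) (ℤ.+<+ lt))))

ι-mono-< : ∀ m n → m ℕ.< n → ι m ℚ.< ι n
ι-mono-< m n m<n = ℚ.toℚᵘ-cancel-<
  (ℚᵘ.<-respˡ-≃ (ℚᵘ.≃-sym (toℚᵘ-/ (+ m) 1)) (ℚᵘ.<-respʳ-≃ (ℚᵘ.≃-sym (toℚᵘ-/ (+ n) 1))
    (*<* (subst₂ ℤ._<_ (sym (ℤ.*-identityʳ (+ m))) (sym (ℤ.*-identityʳ (+ n))) (ℤ.+<+ m<n)))))

0≤ι : ∀ n → 0ℚ ℚ.≤ ι n
0≤ι zero    = ℚ.≤-refl
0≤ι (suc n) = ℚ.<⇒≤ (ι-mono-< 0 (suc n) (s≤s z≤n))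

ι-↧*p : ∀ p s-1 .(c : Coprime p (suc s-1)) → ι (suc s-1) ℚ.* mkℚ (+ p) s-1 c ≡ ι p
ι-↧*p p s-1 c = ℚ.toℚᵘ-injective (begin
  toℚᵘ (ι s ℚ.* mkℚ (+ p) s-1 c)   ≈⟨ ℚ.toℚᵘ-homo-* (ι s) (mkℚ (+ p) s-1 c) ⟩
  toℚᵘ (ι s) ℚᵘ.* mkℚᵘ (+ p) s-1   ≈⟨ ℚᵘ.*-congʳ (toℚᵘ-/ (+ s) 1) ⟩
  (+ s ℚᵘ./ 1) ℚᵘ.* mkℚᵘ (+ p) s-1 ≈⟨ *≡* eq ⟩
  + p ℚᵘ./ 1                       ≈⟨ toℚᵘ-/ (+ p) 1 ⟨
  toℚᵘ (ι p)                       ∎)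
  where
  open ℚᵘ.≃-Reasoning
  s = suc s-1
  eq : (+ s ℤ.* + p) ℤ.* + 1 ≡ + p ℤ.* + (s ℕ.+ 0)
  eq rewrite ℕ.+-identityʳ s = trans (ℤ.*-identityʳ _) (ℤ.*-comm (+ s) (+ p))

a+b-a : ∀ a b → a ℚ.+ b ℚ.- a ≡ b
a+b-a = solve 2 (λ a b → a :+ b :- a := b) refl
  where open +-*-Solver

a-[a+b] : ∀ a b → a ℚ.- (a ℚ.+ b) ≡ ℚ.- b
a-[a+b] = solve 2 (λ a b → a :- (a :+ b) := :- b) refl
  where open +-*-Solver

swap-right : ∀ a b c → a ℚ.* b ℚ.* c ≡ a ℚ.* c ℚ.* b
swap-right = solve 3 (λ a b c → a :* b :* c := a :* c :* b) refl
  where open +-*-Solver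

rotate : ∀ a b c → a ℚ.* (b ℚ.* c) ≡ c ℚ.* a ℚ.* b
rotate = solve 3 (λ a b c → a :* (b :* c) := c :* a :* b) refl
  where open +-*-Solver

distrib-- : ∀ a b c → (a ℚ.- b) ℚ.* c ≡ a ℚ.* c ℚ.- b ℚ.* c
distrib-- = solve 3 (λ a b c → (a :- b) :* c := a :* c :- b :* c) refl
  where open +-*-Solver

-- Order in ℚ

*-monoˡ-<′ : ∀ {p q} r → 0ℚ ℚ.< r → p ℚ.< q → p ℚ.* r ℚ.< q ℚ.* r
*-monoˡ-<′ r 0<r = ℚ.*-monoˡ-<-pos r {{positive 0<r}}

*-monoʳ-≤′ : ∀ {p q} r → 0ℚ ℚ.≤ r → p ℚ.≤ q → p ℚ.* r ℚ.≤ q ℚ.* r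
*-monoʳ-≤′ r 0≤r = ℚ.*-monoʳ-≤-nonNeg r {{nonNegative 0≤r}}

*-cancelʳ-<′ : ∀ {p q} r → 0ℚ ℚ.< r → p ℚ.* r ℚ.< q ℚ.* r → p ℚ.< q
*-cancelʳ-<′ r 0<r = ℚ.*-cancelʳ-<-nonNeg r {{nonNegative (ℚ.<⇒≤ 0<r)}}

-- Multiplication by `c` is monotone or antitone according to the sign of `c`, so on an interval its
-- minimum is at an endpoint. This undoes the four-product definition of `*ʳ` when one factor is
-- rational.
between-lower : ∀ {a m b q} c → a ℚ.≤ m → m ℚ.≤ b → q ℚ.< a ℚ.* c → q ℚ.< b ℚ.* c → q ℚ.< m ℚ.* c
between-lower c a≤m m≤b q<ac q<bc with ℚ.≤-total 0ℚ c
... | inj₁ 0≤c = ℚ.<-≤-trans q<ac (*-monoʳ-≤′ c 0≤c a≤m)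
... | inj₂ c≤0 = ℚ.<-≤-trans q<bc (ℚ.*-monoʳ-≤-nonPos c {{ℚ.nonPositive c≤0}} m≤b)

between-upper : ∀ {a m b q} c → a ℚ.≤ m → m ℚ.≤ b → a ℚ.* c ℚ.< q → b ℚ.* c ℚ.< q → m ℚ.* c ℚ.< q
between-upper c a≤m m≤b ac<q bc<q with ℚ.≤-total 0ℚ c
... | inj₁ 0≤c = ℚ.≤-<-trans (*-monoʳ-≤′ c 0≤c m≤b) bc<q
... | inj₂ c≤0 = ℚ.≤-<-trans (ℚ.*-monoʳ-≤-nonPos c {{ℚ.nonPositive c≤0}} a≤m) ac<q

-- Rational bounds extracted from the cut operations

upper-fromℚ-* : ∀ m {y q} → upper (fromℚ m *ʳ y) q → ∃[ d ] upper y d × m ℚ.* d ℚ.< q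
upper-fromℚ-* m (a , b , _ , d , (a<m , m<b) , (_ , yd) , _ , ad<q , _ , bd<q) =
  d , yd , between-upper d (ℚ.<⇒≤ a<m) (ℚ.<⇒≤ m<b) ad<q bd<q

-ʳ-mono : ∀ {a b c d} → a ℚ.< c → d ℚ.< b → a ℚ.- b ℚ.< c ℚ.- d
-ʳ-mono a<c d<b = ℚ.+-mono-< a<c (ℚ.neg-antimono-< d<b)

lower-[p-1]* : ∀ p {y q} → lower ((fromℚ p -ʳ fromℕ 1) *ʳ y) q → ∃[ c ] lower y c × q ℚ.< (p ℚ.- 1ℚ) ℚ.* c
lower-[p-1]* p (_ , _ , c , _ , ((_ , _ , a₁<p , 1<a₂ , a<) , (_ , _ , p<b₁ , b₂<1 , <b)) ,
  (yc , _) , q<ac , _ , q<bc , _) =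
  c , yc , between-lower c
    (ℚ.<⇒≤ (ℚ.<-trans a< (-ʳ-mono a₁<p 1<a₂)))
    (ℚ.<⇒≤ (ℚ.<-trans (-ʳ-mono p<b₁ b₂<1) <b))
    q<ac q<bc

0<1 : 0ℚ ℚ.< 1ℚ
0<1 = ι-mono-< 0 1 (s≤s z≤n)

upper-⁻¹ : ∀ p {q} → upper (fromℚ p ⁻¹ʳ) q → 1ℚ ℚ.< q ℚ.* p
upper-⁻¹ p {q} (r , r<p , 0<r , 1<qr) = ℚ.<-trans 1<qr (ℚ.*-monoʳ-<-pos q {{positive 0<q}} r<p)
  where
  0<q : 0ℚ ℚ.< q
  0<q = *-cancelʳ-<′ r 0<r (subst (ℚ._< q ℚ.* r) (sym (ℚ.*-zeroˡ r)) (ℚ.<-trans 0<1 1<qr))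

-- Instantiated with L = log n and c = n choose 2.
module _ (L : Cut) (n c d : ℚ) (0<n : 0ℚ ℚ.< n) (0≤c : 0ℚ ℚ.≤ c) (0≤d : 0ℚ ℚ.≤ d)
         (n[n-1]≡2c : n ℚ.* (n ℚ.- 1ℚ) ≡ (+ 2 ℚ./ 1) ℚ.* c)
         (c< : ∀ {l} → upper L l → c ℚ.< l ℚ.* (1ℚ ℚ.+ n ℚ.* d)) where

  private
    2ℚ N E : ℚ
    2ℚ = + 2 ℚ./ 1
    N = n ℚ.* (n ℚ.- 1ℚ)
    E = 1ℚ ℚ.+ n ℚ.* d

    0<E : 0ℚ ℚ.< E
    0<E = ℚ.+-mono-<-≤ 0<1 (subst (ℚ._≤ n ℚ.* d) (ℚ.*-zeroˡ d) (*-monoʳ-≤′ d 0≤d (ℚ.<⇒≤ 0<n)))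

    0≤N : 0ℚ ℚ.≤ N
    0≤N = subst (0ℚ ℚ.≤_) (sym n[n-1]≡2c) (ℚ.*-monoˡ-≤-nonNeg 2ℚ 0≤c)

  -- From `r` above `2L` one gets `N = 2c < 2lE < rE`; with `q r < 1` and `N` nonnegative,
  -- `q N r ≤ N < E r`, and `r` cancels.
  lower-[2L]⁻¹ : ∀ {q} → lower ((fromℕ 2 *ʳ L) ⁻¹ʳ) q → q ℚ.* N ℚ.< E
  lower-[2L]⁻¹ {q} (r , 2L<r , 0<r , qr<1) with upper-fromℚ-* 2ℚ {L} 2L<r
  ... | l , L<l , 2l<r = *-cancelʳ-<′ r 0<r (begin-strict
    q ℚ.* N ℚ.* r       ≡⟨ swap-right q N r ⟩
    q ℚ.* r ℚ.* N       ≤⟨ *-monoʳ-≤′ N 0≤N (ℚ.<⇒≤ qr<1) ⟩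
    1ℚ ℚ.* N            ≡⟨ ℚ.*-identityˡ N ⟩
    N                   ≡⟨ n[n-1]≡2c ⟩
    2ℚ ℚ.* c            <⟨ ℚ.*-monoʳ-<-pos 2ℚ (c< L<l) ⟩
    2ℚ ℚ.* (l ℚ.* E)    ≡⟨ ℚ.*-assoc 2ℚ l E ⟨
    2ℚ ℚ.* l ℚ.* E      <⟨ *-monoˡ-<′ E 0<E 2l<r ⟩
    r ℚ.* E             ≡⟨ ℚ.*-comm r E ⟩
    E ℚ.* r             ∎)
    where open ℚ.≤-Reasoning

  lower-[n-1]/2L : ∀ {q} → lower ((fromℚ n -ʳ fromℕ 1) *ʳ (fromℕ 2 *ʳ L) ⁻¹ʳ) q → q ℚ.* n ℚ.< E
  lower-[n-1]/2L {q} lq with lower-[p-1]* n {(fromℕ 2 *ʳ L) ⁻¹ʳ} lq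
  ... | p , lp , q< = ℚ.<-trans (*-monoˡ-<′ n 0<n q<)
    (subst (ℚ._< E) (rotate p n (n ℚ.- 1ℚ)) (lower-[2L]⁻¹ {p} lp))

  -- After multiplication by `n`, subtracting the reciprocal of `n` removes the 1 in `E`. That 1 is
  -- the extra factor `n` in `Large`.
  lower-[n-1]/2L-n⁻¹ : ∀ {q} →
    lower ((fromℚ n -ʳ fromℕ 1) *ʳ (fromℕ 2 *ʳ L) ⁻¹ʳ -ʳ fromℚ n ⁻¹ʳ) q → q ℚ.< d
  lower-[n-1]/2L-n⁻¹ {q} (a , b , la , ub , q<a-b) = *-cancelʳ-<′ n 0<n (begin-strict
    q ℚ.* n                <⟨ *-monoˡ-<′ n 0<n q<a-b ⟩
    (a ℚ.- b) ℚ.* n        ≡⟨ distrib-- a b n ⟩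
    a ℚ.* n ℚ.- b ℚ.* n    <⟨ -ʳ-mono (lower-[n-1]/2L la) (upper-⁻¹ n {b} ub) ⟩
    E ℚ.- 1ℚ               ≡⟨ a+b-a 1ℚ (n ℚ.* d) ⟩
    n ℚ.* d                ≡⟨ ℚ.*-comm n d ⟩
    d ℚ.* n                ∎)
    where open ℚ.≤-Reasoning

-- The logarithm

2*[1+n]C2 : ∀ n → 2 ℕ.* (suc n C 2) ≡ suc n ℕ.* n
2*[1+n]C2 zero    = refl
2*[1+n]C2 (suc n) = begin
  2 ℕ.* (suc (suc n) C 2)                ≡⟨ cong (2 ℕ.*_) (nCk+nC[k+1]≡[n+1]C[k+1] (suc n) 1) ⟨
  2 ℕ.* (suc n C 1 ℕ.+ suc n C 2)        ≡⟨ cong (λ k → 2 ℕ.* (k ℕ.+ suc n C 2)) (nC1≡n (suc n)) ⟩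
  2 ℕ.* (suc n ℕ.+ suc n C 2)            ≡⟨ ℕ.*-distribˡ-+ 2 (suc n) (suc n C 2) ⟩
  2 ℕ.* suc n ℕ.+ 2 ℕ.* (suc n C 2)      ≡⟨ cong (2 ℕ.* suc n ℕ.+_) (trans (2*[1+n]C2 n) (ℕ.*-comm (suc n) n)) ⟩
  2 ℕ.* suc n ℕ.+ n ℕ.* suc n            ≡⟨ ℕ.*-distribʳ-+ (suc n) 2 n ⟨
  suc (suc n) ℕ.* suc n                  ∎
  where open ≡-Reasoning

^-cancelʳ-< : ∀ b .{{_ : ℕ.NonZero b}} {m n} → b ^ m ℕ.< b ^ n → m ℕ.< n
^-cancelʳ-< b lt = ℕ.≰⇒> λ n≤m → ℕ.<⇒≱ lt (ℕ.^-monoʳ-≤ b n≤m)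

-- For `r = p / s` above `log n`, the chain `2 ^ (a s) < n ^ (b s) < 2 ^ (p b)` gives `a s < p b`.
log-upper : ∀ {n} .{{_ : ℕ.NonZero n}} a b {r} .{{_ : ℕ.NonZero b}} → 2 ^ a ℕ.< n ^ b →
            upper (log n) r → ι a ℚ.< r ℚ.* ι b
log-upper {n} a b {mkℚ (+ p) s-1 c} a<b u =
  ℚ.*-cancelˡ-<-nonNeg (ι s) {{nonNegative (0≤ι s)}} (begin-strict
    ι s ℚ.* ι a                          ≡⟨ ι-* s a ⟩
    ι (s ℕ.* a)                          <⟨ ι-mono-< (s ℕ.* a) (p ℕ.* b) (^-cancelʳ-< 2 power) ⟩
    ι (p ℕ.* b)                          ≡⟨ ι-* p b ⟨
    ι p ℚ.* ι b                          ≡⟨ cong (ℚ._* ι b) (ι-↧*p p s-1 c) ⟨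
    ι s ℚ.* mkℚ (+ p) s-1 c ℚ.* ι b      ≡⟨ ℚ.*-assoc (ι s) (mkℚ (+ p) s-1 c) (ι b) ⟩
    ι s ℚ.* (mkℚ (+ p) s-1 c ℚ.* ι b)    ∎)
  where
  open ℚ.≤-Reasoning
  s = suc s-1
  power : 2 ^ (s ℕ.* a) ℕ.< 2 ^ (p ℕ.* b)
  power = subst₂ ℕ._<_
      (trans (ℕ.^-*-assoc 2 a s) (cong (2 ^_) (ℕ.*-comm a s)))
      (ℕ.^-*-assoc 2 p b)
      (ℕ.<-trans (ℕ.^-monoˡ-< s a<b)
        (subst (ℕ._< (2 ^ p) ^ b)
          (trans (ℕ.^-*-assoc n s b) (trans (cong (n ^_) (ℕ.*-comm s b)) (sym (ℕ.^-*-assoc n b s))))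
          (ℕ.^-monoˡ-< b u)))
-- A negative `r` is no upper bound: it would make a product of positive naturals less than 1.
log-upper {n} a b {mkℚ -[1+ p ] s-1 _} a<b u =
  contradiction u (ℕ.≤⇒≯ (ℕ.>-nonZero⁻¹ (2 ^ suc p ℕ.* n ^ suc s-1)
    {{ℕ.m*n≢0 (2 ^ suc p) (n ^ suc s-1) {{ℕ.m^n≢0 2 (suc p)}} {{ℕ.m^n≢0 n (suc s-1)}}}}))

-- Dividing by `1 + ε > 1` preserves a nonnegative upper bound `p`. The lower approximation `a` of
-- the reciprocal may be negative, hence the case split.
lower-[1+ε]⁻¹* : ∀ {ε} → IsReal ε → fromℕ 0 <ʳ ε → ∀ {y p} → 0ℚ ℚ.≤ p → (∀ {c} → lower y c → c ℚ.< p) →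
                 ∀ {q} → lower ((fromℕ 1 +ʳ ε) ⁻¹ʳ *ʳ y) q → q ℚ.< p
lower-[1+ε]⁻¹* {ε} real (e , 0<e , le) {y} {p} 0≤p y≤p {q}
  (a , b , c , _ , ((r , (r₁ , r₂ , 1<r₁ , ε<r₂ , r₁+r₂<r) , 0<r , ar<1) , (s , _ , 0<s , 1<bs)) ,
   (yc , _) , q<ac , _ , q<bc , _)
  with ℚ.≤-total 0ℚ a
-- Now 0 lies between `a` and `b`, so `q` is below `0 * c`, which is at most `p`.
... | inj₂ a≤0 = ℚ.<-≤-trans
        (subst (q ℚ.<_) (ℚ.*-zeroˡ c) (between-lower c a≤0 (ℚ.<⇒≤ 0<b) q<ac q<bc)) 0≤p
  where
  0<b : 0ℚ ℚ.< b
  0<b = *-cancelʳ-<′ s 0<s (subst (ℚ._< b ℚ.* s) (sym (ℚ.*-zeroˡ s)) (ℚ.<-trans 0<1 1<bs))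
... | inj₁ 0≤a = begin-strict
  q         <⟨ q<ac ⟩
  a ℚ.* c   ≤⟨ ℚ.*-monoˡ-≤-nonNeg a {{nonNegative 0≤a}} (ℚ.<⇒≤ (y≤p yc)) ⟩
  a ℚ.* p   ≤⟨ *-monoʳ-≤′ p 0≤p (ℚ.<⇒≤ a<1) ⟩
  1ℚ ℚ.* p  ≡⟨ ℚ.*-identityˡ p ⟩
  p         ∎
  where
  open ℚ.≤-Reasoning
  -- Otherwise `r₂` would be below the positive lower bound `e` and so belong to both halves of the
  -- cut `ε`.
  0<r₂ : 0ℚ ℚ.< r₂
  0<r₂ = ℚ.≰⇒> λ r₂≤0 → IsReal.disjoint real
    (IsReal.lower-closed real (ℚ.≤-<-trans r₂≤0 0<e) le) ε<r₂
  1<r : 1ℚ ℚ.< r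
  1<r = ℚ.<-trans (ℚ.+-mono-< 1<r₁ 0<r₂) r₁+r₂<r
  a<1 : a ℚ.< 1ℚ
  a<1 = ℚ.≰⇒> λ 1≤a → ℚ.<-irrefl refl (ℚ.<-trans 1<r (ℚ.≤-<-trans
    (subst (ℚ._≤ a ℚ.* r) (ℚ.*-identityˡ r) (*-monoʳ-≤′ r (ℚ.<⇒≤ 0<r) 1≤a)) ar<1))

-- `log-upper` with exponents `n C 2` and `n d + 1` turns `Large` into the hypothesis `c<` of the
-- module above; the factor with `ε` is then absorbed.
large⇒bound≤ : ∀ {ε} → IsReal ε → fromℕ 0 <ʳ ε → ∀ n .{{_ : ℕ.NonZero n}} d → Large n d →
               bound ε n ≤ʳ fromℕ d
large⇒bound≤ real 0<ε n@(suc m) d large q = lower-[1+ε]⁻¹* real 0<ε (0≤ι d)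
  (lower-[n-1]/2L-n⁻¹ (log n) (ι n) (ι (n C 2)) (ι d) (ι-mono-< 0 n (s≤s z≤n)) (0≤ι (n C 2)) (0≤ι d)
    n[n-1]≡2C
    (λ {l} log<l → subst (λ e → ι (n C 2) ℚ.< l ℚ.* e) E≡ (log-upper (n C 2) (suc (n ℕ.* d)) {l} large log<l)))
  where
  E≡ : ι (suc (n ℕ.* d)) ≡ 1ℚ ℚ.+ ι n ℚ.* ι d
  E≡ = trans (sym (ι-+ 1 (n ℕ.* d))) (cong (1ℚ ℚ.+_) (sym (ι-* n d)))

  n[n-1]≡2C : ι n ℚ.* (ι n ℚ.- 1ℚ) ≡ ι 2 ℚ.* ι (n C 2)
  n[n-1]≡2C = begin
    ι n ℚ.* (ι n ℚ.- 1ℚ)          ≡⟨ cong (λ p → ι n ℚ.* (p ℚ.- 1ℚ)) (ι-+ 1 m) ⟨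
    ι n ℚ.* (1ℚ ℚ.+ ι m ℚ.- 1ℚ)   ≡⟨ cong (ι n ℚ.*_) (a+b-a 1ℚ (ι m)) ⟩
    ι n ℚ.* ι m                   ≡⟨ ι-* n m ⟩
    ι (n ℕ.* m)                   ≡⟨ cong ι (2*[1+n]C2 m) ⟨
    ι (2 ℕ.* (n C 2))             ≡⟨ ι-* 2 (n C 2) ⟨
    ι 2 ℚ.* ι (n C 2)             ∎
    where open ≡-Reasoning

-- Convergence of the proportions

n/n≡1 : ∀ n .{{_ : ℕ.NonZero n}} → + n ℚ./ n ≡ 1ℚ
n/n≡1 n@(suc _) = ℚ.toℚᵘ-injective (ℚᵘ.≃-trans (toℚᵘ-/ (+ n) n) (*≡* (ℤ.*-comm (+ n) (+ 1))))

∣k/m-1∣ : ∀ {k l m} .{{_ : ℕ.NonZero m}} → k ℕ.+ l ≡ m → ℚ.∣ (+ k ℚ./ m) ℚ.- 1ℚ ∣ ≡ + l ℚ./ m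
∣k/m-1∣ {k} {l} {m} k+l≡m = begin
  ℚ.∣ x ℚ.- 1ℚ ∣           ≡⟨ cong (λ z → ℚ.∣ x ℚ.- z ∣) (sym x+y≡1) ⟩
  ℚ.∣ x ℚ.- (x ℚ.+ y) ∣    ≡⟨ cong ℚ.∣_∣ (a-[a+b] x y) ⟩
  ℚ.∣ ℚ.- y ∣              ≡⟨ ℚ.∣-p∣≡∣p∣ y ⟩
  ℚ.∣ y ∣                  ≡⟨ ℚ.0≤p⇒∣p∣≡p (ℚ.nonNegative⁻¹ y {{ℚ.normalize-nonNeg l m}}) ⟩
  y                        ∎
  where
  open ≡-Reasoning
  x y : ℚ
  x = + k ℚ./ m
  y = + l ℚ./ m
  x+y≡1 : x ℚ.+ y ≡ 1ℚ
  x+y≡1 = trans (/-+-/ k l m) (trans (cong (λ z → + z ℚ./ m) k+l≡m) (n/n≡1 m))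

-- The exceptions `l` form at most a fraction `1/n` of all graphs, which gives convergence with an
-- explicit rate.
Complement : (ℕ → ℕ) → Set
Complement N = ∀ n → 2 ℕ.≤ n → ∃[ l ] N n ℕ.+ l ≡ 2 ^ (n C 2) × n ℕ.* l ℕ.≤ 2 ^ (n C 2)

proportion⟶1 : ∀ N → Complement N → (λ n → proportion n (N n)) ⟶ 1ℚ
proportion⟶1 N comp (mkℚ -[1+ _ ] _ _) (ℚ.*<* ())
proportion⟶1 N comp (mkℚ (+ 0) _ _) (ℚ.*<* (ℤ.+<+ ()))
-- With `q` the denominator of `δ`, every `n > q` has `1/n < 1/q ≤ δ`. As `q` is positive, the
-- threshold `suc q` also ensures `n ≥ 2`.
proportion⟶1 N comp δ@(mkℚ (+ (suc p)) q-1 c) _ = suc q , close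
  where
  q = suc q-1
  close : ∀ n → suc q ℕ.≤ n → ℚ.∣ proportion n (N n) ℚ.- 1ℚ ∣ ℚ.< δ
  close n q<n with comp n (ℕ.≤-trans (s≤s (s≤s z≤n)) q<n)
  ... | l , N+l≡M , nl≤M = subst (ℚ._< δ) (sym (∣k/m-1∣ {N n} {l} {{M≢0}} N+l≡M))
    (/-<-ℚ l M {{M≢0}} (suc p) q-1 c (ℕ.<-≤-trans (lq<M l nl≤M) (ℕ.m≤m+n M (p ℕ.* M))))
    where
    M = 2 ^ (n C 2)
    M≢0 = ℕ.m^n≢0 2 (n C 2)
    lq<M : ∀ l → n ℕ.* l ℕ.≤ M → l ℕ.* q ℕ.< M
    -- With `l = 0` the strict step from `l * q` to `l * n` fails; positivity of `M` replaces it.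
    lq<M zero      _    = ℕ.m^n>0 2 (n C 2)
    lq<M l@(suc _) nl≤M = begin-strict
      l ℕ.* q      <⟨ ℕ.*-monoʳ-< l q<n ⟩
      l ℕ.* n      ≡⟨ ℕ.*-comm l n ⟩
      n ℕ.* l      ≤⟨ nl≤M ⟩
      M            ∎
      where open ℕ.≤-Reasoning

theorem5 : (ε : Cut) → IsReal ε → fromℕ 0 <ʳ ε →
    AlmostAll (λ n G → Σ[ d ∈ ℕ ] IsPragueDim G d × bound ε n ≤ʳ fromℕ d)
theorem5 ε real 0<ε = (k , atLeast , proportion⟶1 k k-complement) , λ N exactly →
  proportion⟶1 N λ n 2≤n → N-complement n (N n) (exactly n) (k-complement n 2≤n)
  where
  P : GraphProperty
  P n G = Σ[ d ∈ ℕ ] IsPragueDim G d × bound ε n ≤ʳ fromℕ d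

  many : ∀ n → Σ[ k ∈ ℕ ] AtLeast k (P n) ×
         (2 ℕ.≤ n → ∃[ l ] k ℕ.+ l ≡ 2 ^ (n C 2) × n ℕ.* l ℕ.≤ 2 ^ (n C 2))
  -- Below two vertices an empty list will do: `Complement` constrains only `n ≥ 2`.
  many 0 = 0 , ((λ ()) , (λ { {()} }) , λ ()) , λ ()
  many 1 = 0 , ((λ ()) , (λ { {()} }) , λ ()) , λ { (s≤s ()) }
  many n@(suc (suc _)) =
    let k , l , total , n*l≤ , f , f-inj , f-P = most-large n (s≤s (s≤s z≤n)) in
    k , (f , f-inj , λ i → let d , isDim , large = f-P i in d , isDim , large⇒bound≤ real 0<ε n d large) ,
    λ _ → l , total , n*l≤

  k : ℕ → ℕ
  k n = proj₁ (many n)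

  atLeast : ∀ n → AtLeast (k n) (P n)
  atLeast n = proj₁ (proj₂ (many n))

  k-complement : Complement k
  k-complement n = proj₂ (proj₂ (many n))

  -- An exact count is at least `k n`, so it leaves at most `l` exceptions. By `lists-≤` it does not
  -- exceed `M`, so the truncated difference `M ∸ N` is the true complement.
  N-complement : ∀ n N → Exactly N (P n) →
    ∃[ l ] k n ℕ.+ l ≡ 2 ^ (n C 2) × n ℕ.* l ℕ.≤ 2 ^ (n C 2) →
    ∃[ l ] N ℕ.+ l ≡ 2 ^ (n C 2) × n ℕ.* l ℕ.≤ 2 ^ (n C 2)
  N-complement n N exactly@(f , lists , _) (l , k+l≡M , nl≤M) =
    M ℕ.∸ N , ℕ.m+[n∸m]≡n (lists-≤ {P = P n} (f , lists)) , ℕ.≤-trans (ℕ.*-monoʳ-≤ n M∸N≤l) nl≤M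
    where
    M = 2 ^ (n C 2)
    M∸N≤l : M ℕ.∸ N ℕ.≤ l
    M∸N≤l = begin
      M ℕ.∸ N              ≤⟨ ℕ.∸-monoʳ-≤ M (atLeast-≤-exactly {P = P n} (atLeast n) exactly) ⟩
      M ℕ.∸ k n            ≡⟨ cong (ℕ._∸ k n) k+l≡M ⟨
      k n ℕ.+ l ℕ.∸ k n    ≡⟨ ℕ.m+n∸m≡n (k n) l ⟩
      l                    ∎
      where open ℕ.≤-Reasoning
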